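{- Let $G$ and $H$ be graphs. Then any cell of $\pi\mathrm{Hom}(G,H)$ is a generalized permutohedron, and any generalized permutohedron occurs as a cell of some $\pi\mathrm{Hom}(G,H)$. Moreover, a cell $\pi(\sigma)$ of $\pi\mathrm{Hom}(G,H)$, where $\sigma=\sigma_1\times\dots\times\sigma_g$ is a cell of $\mathrm{Hom}(G,H)$, is a product of simplices if and only if $\sigma_i\cap\sigma_j=\emptyset$ for all $i\ne j$.
   Context: Graphs are finite and undirected, $V(G)=[g]$, $V(H)=[h]$. For a finite set $B$, $\Delta_B=\mathrm{conv}\{e_i:i\in B\}$; subsets of $B$ are identified with faces of $\Delta_B$. $\mathrm{Hom}(G,H)$ is the polytopal complex of all cells $\times_{i\in V(G)}\sigma_i$ (all $\sigma_i\subset V(H)$ nonempty) of $\times_{i\in V(G)}\Delta_{V(H)}$ such that if $(i,j)\in E(G)$, then $(\sigma_i,\sigma_j)$ is a complete bipartite subgraph of $H$, i.e. every $(u,v)\in\sigma_i\times\sigma_j$ is an edge of $H$. With $\mu_i:\mathbb R^h\hookrightarrow\mathbb R^{gh}=(\mathbb R^h)^g$ the inclusion as $i$-th block, $\mathrm{Hom}(G,H)$ is realized in $\mathbb R^{gh}$ with cells $\frac1g(\mu_1(\sigma_1)\times\dots\times\mu_g(\sigma_g))$. The map $\pi=\pi_\Delta\pi_\Box:\mathbb R^{gh}\times\mathbb R^g\to\mathbb R^h$ is $(x_1,\dots,x_g,y)\mapsto x_1+\dots+x_g$ ($x_i\in\mathbb R^h$), applied to $\mathrm{Hom}(G,H)\times(\frac1g,\dots,\frac1g)$,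 and $\pi\mathrm{Hom}(G,H)=\{\pi(\sigma):\sigma\text{ a cell of }\mathrm{Hom}(G,H)\}$; thus $\pi(\sigma)=\frac1g(\sigma_1+\dots+\sigma_g)\subset\Delta_{V(H)}$ (Minkowski sum). More generally, for positive reals $\lambda_1,\dots,\lambda_g$ with $\lambda=\sum_i\lambda_i$, one may use the weights $(\frac{\lambda_1}{\lambda},\dots,\frac{\lambda_g}{\lambda})$ in place of $(\frac1g,\dots,\frac1g)$, so that the cell is $\pi(\sigma)=\frac1\lambda(\lambda_1\sigma_1+\dots+\lambda_g\sigma_g)$. Generalized permutohedra: let $\Gamma\subset K_{m,n}$ be a bipartite graph with $m$ left and $n$ right vertices, with edges $(i,j)$ ($i$ left, $j$ right), and let $I_i=\{j:(i,j)\in\Gamma\}\subset[n]$, all nonempty. For $\lambda_1,\dots,\lambda_m>0$, the generalized permutohedron is $P_\Gamma(\lambda_1,\dots,\lambda_m)=\lambda_1\Delta_{I_1}+\dots+\lambda_m\Delta_{I_m}\subset\mathbb R^n$. In the assertion that any generalized permutohedron occurs as a cell, generalized permutohedra are considered up to overall dilation; $P_\Gamma(1,\dots,1)$ is to occur with the standard weights $\frac1g$, and $P_\Gamma(\lambda_1,\dots,\lambda_m)$ in the realization of $\mathrm{Hom}(G,H)$ with weights proportional to $(\lambda_1,\dots,\lambda_m)$.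
   Formalization: "Product of simplices" is read as a Cartesian product of exactly g dilated coordinate simplices on pairwise disjoint coordinate sets; with the usual meaning "only if" fails, e.g. for G edgeless on 2 vertices and σ=({1},{1}), whose cell is a point. -}

module Defs where

open import Algebra.Apartness.Bundles using (HeytingField)
open import Algebra.Bundles using (CommutativeRing)
import Algebra.Apartness.Properties.HeytingCommutativeRing as HeytingProperties
import Algebra.Properties.Semiring.Sum as SemiringSum
open import Data.Bool.Base using (Bool; T; if_then_else_)
open import Data.Fin.Base using (Fin; zero; suc)
open import Data.Fin.Properties using (_≟_)
open import Data.Fin.Subset using (Subset; Nonempty; Empty; _∩_; _∈_; _∉_)
open import Data.Nat.Base using (ℕ; zero; suc; NonZero)
open import Data.Product.Base using (Σ; ∃; ∃-syntax; _×_; _,_; proj₁; proj₂)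
open import Data.Sum.Base using (_⊎_)
open import Data.Vec.Base using (lookup; tabulate)
open import Data.Vec.Functional using (Vector)
open import Level using (Level; _⊔_) renaming (suc to lsuc)
open import Relation.Binary.Core using (Rel)
open import Relation.Binary.PropositionalEquality.Core using (_≡_; _≢_)
open import Relation.Binary.Structures using (IsStrictPartialOrder)
open import Relation.Nullary.Decidable.Core using (does)
open import Relation.Nullary.Negation.Core using (¬_)
open import Relation.Unary using (Pred; _≐_)
import Relation.Unary as Unary

-- The scalars. The standard library has no real numbers, so everything is
-- done over an arbitrary ordered field. The order is presented constructively
-- (order and apartness determine each other, trichotomy is not assumed), so
-- that both classical ordered fields and constructive reals are instances.
record OrderedField (c ℓ₁ ℓ₂ : Level) : Set (lsuc (c ⊔ ℓ₁ ⊔ ℓ₂)) where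
  field
    heytingField : HeytingField c ℓ₁ ℓ₂

  open HeytingField heytingField public renaming (zero to *-zero)

  infix 4 _<_ _≤_

  field
    _<_                  : Rel Carrier ℓ₂
    isStrictPartialOrder : IsStrictPartialOrder _≈_ _<_
    #⇒<⊎>                : ∀ {x y} → x # y → x < y ⊎ y < x
    <⇒#                  : ∀ {x y} → x < y → x # y
    +-monoˡ-<            : ∀ {x y} z → x < y → x + z < y + z
    *-pos                : ∀ {x y} → 0# < x → 0# < y → 0# < x * y

  _≤_ : Rel Carrier ℓ₂
  x ≤ y = ¬ (y < x)

  commutativeRing : CommutativeRing c ℓ₁
  commutativeRing = record { isCommutativeRing = isCommutativeRing }

  open SemiringSum (CommutativeRing.semiring commutativeRing) public
    using (sum; sum-syntax)

  module < = IsStrictPartialOrder isStrictPartialOrder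

  +-pos : ∀ {x y} → 0# < x → 0# < y → 0# < x + y
  +-pos {x} {y} 0<x 0<y =
    <.trans 0<y (<.<-respˡ-≈ (+-identityˡ y) (+-monoˡ-< y 0<x))

  sum-pos : ∀ {n} .{{_ : NonZero n}} (t : Vector Carrier n) →
            (∀ i → 0# < t i) → 0# < sum t
  sum-pos {zero} {{()}}
  sum-pos {suc zero}    t 0<t = <.<-respʳ-≈ (sym (+-identityʳ _)) (0<t zero)
  sum-pos {suc (suc n)} t 0<t =
    +-pos (0<t zero) (sum-pos (λ i → t (suc i)) (λ i → 0<t (suc i)))

  inv : ∀ x → 0# < x → Carrier
  inv x 0<x = proj₁ (#⇒invertible (#-sym (<⇒# 0<x)))

  inv-inverseʳ : ∀ x (0<x : 0# < x) → x * inv x 0<x ≈ 1#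
  inv-inverseʳ x 0<x = trans (*-congʳ (sym (x-0≈x x)))
    (proj₂ (proj₂ (#⇒invertible (#-sym (<⇒# 0<x)))))
    where open HeytingProperties heytingCommutativeRing using (x-0≈x)

-- Loops are allowed: graphs are only required to be finite and undirected.
record Graph (n : ℕ) : Set where
  field
    adjacent  : Fin n → Fin n → Bool
    symmetric : ∀ u v → adjacent u v ≡ adjacent v u

  Edge : Fin n → Fin n → Set
  Edge u v = T (adjacent u v)

-- The cells σ₁ × … × σ_g of Hom(G,H), each given by its tuple of faces σᵢ.
IsHomCell : ∀ {g h} → Graph g → Graph h → (Fin g → Subset h) → Set
IsHomCell G H σ =
  (∀ i → Nonempty (σ i)) ×
  (∀ i j → Graph.Edge G i j →
     ∀ u v → u ∈ σ i → v ∈ σ j → Graph.Edge H u v)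

-- Subgraphs Γ of K_{m,n} in which every left vertex has a neighbour.
record BipartiteGraph (m n : ℕ) : Set where
  field
    adjacent : Fin m → Fin n → Bool

  I : Fin m → Subset n
  I i = tabulate (adjacent i)

  field
    I-nonempty : ∀ i → Nonempty (I i)

PairwiseDisjoint : ∀ {k n} → (Fin k → Subset n) → Set
PairwiseDisjoint σ = ∀ i j → i ≢ j → Empty (σ i ∩ σ j)

module Polytopes {c ℓ₁ ℓ₂ : Level} (K : OrderedField c ℓ₁ ℓ₂) where

  open OrderedField K

  Point : ℕ → Set c
  Point n = Vector Carrier n

  infix 4 _≋_
  _≋_ : ∀ {n} → Rel (Point n) ℓ₁
  x ≋ y = ∀ v → x v ≈ y v

  PointSet : ℕ → Set (lsuc (c ⊔ ℓ₁ ⊔ ℓ₂))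
  PointSet n = Pred (Point n) (c ⊔ ℓ₁ ⊔ ℓ₂)

  conv : ∀ {n ℓ} → Pred (Point n) ℓ → Pred (Point n) (c ⊔ ℓ₁ ⊔ ℓ₂ ⊔ ℓ)
  conv S x = ∃[ k ] Σ (Fin k → Point _) λ p → Σ (Vector Carrier k) λ t →
    (∀ i → p i Unary.∈ S) ×
    (∀ i → 0# ≤ t i) ×
    sum t ≈ 1# ×
    (x ≋ λ v → ∑[ i < k ] (t i * p i v))

  e : ∀ {n} → Fin n → Point n
  e i v = if does (i ≟ v) then 1# else 0#

  Δ : ∀ {n} → Subset n → PointSet n
  Δ B = conv (λ x → ∃[ i ] i ∈ B × x ≋ e i)

  infixr 7 _•_
  _•_ : ∀ {n} → Carrier → PointSet n → PointSet n
  (r • Q) x = ∃[ q ] q Unary.∈ Q × (x ≋ λ v → r * q v)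

  MinkowskiSum : ∀ {k n} → (Fin k → PointSet n) → PointSet n
  MinkowskiSum {k} {n} Q x = Σ (Fin k → Point n) λ p →
    (∀ i → p i Unary.∈ Q i) × (x ≋ λ v → ∑[ i < k ] p i v)

  record Positives (m : ℕ) : Set (c ⊔ ℓ₂) where
    field
      value    : Vector Carrier m
      positive : ∀ i → 0# < value i

  open Positives public

  P⟨_⟩ : ∀ {m n} → BipartiteGraph m n → Positives m → PointSet n
  P⟨ Γ ⟩ λs = MinkowskiSum (λ i → value λs i • Δ (BipartiteGraph.I Γ i))

  -- m is positive because the left vertices of Γ index a nonempty family of
  -- summands, just as the vertices of G do below.
  IsGeneralizedPermutohedron : ∀ {n} → PointSet n → Set (c ⊔ ℓ₁ ⊔ ℓ₂)
  IsGeneralizedPermutohedron {n} P =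
    ∃[ m ] NonZero m × Σ (BipartiteGraph m n) λ Γ → Σ (Positives m) λ λs →
      P ≐ P⟨ Γ ⟩ λs

  π : ∀ {g h} → (Fin g → Point h) × Point g → Point h
  π {g} (x , _) v = ∑[ i < g ] x i v

  module _ {g : ℕ} .{{_ : NonZero g}} (λs : Positives g) where

    total : Carrier
    total = sum (value λs)

    -- The weights λᵢ/λ; for λ₁ = … = λ_g these are the standard weights 1/g.
    weight : Vector Carrier g
    weight i = value λs i * inv total (sum-pos (value λs) (positive λs))

    -- The cell of Hom(G,H) with tuple of faces σ, realized in (ℝʰ)ᵍ × ℝᵍ: the
    -- product of the (λᵢ/λ) σᵢ, placed in the i-th block, times the weights.
    realize : ∀ {h} → (Fin g → Subset h) →
              Pred ((Fin g → Point h) × Point g) (c ⊔ ℓ₁ ⊔ ℓ₂)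
    realize σ (x , y) = (∀ i → x i Unary.∈ weight i • Δ (σ i)) × y ≋ weight

    πCell : ∀ {h} → (Fin g → Subset h) → PointSet h
    πCell σ z = ∃[ x ] x Unary.∈ realize σ × z ≋ π x

    πHom : ∀ {h} → Graph g → Graph h → Pred (PointSet h) (c ⊔ ℓ₁ ⊔ ℓ₂)
    πHom G H P = ∃[ σ ] IsHomCell G H σ × P ≐ πCell σ

  restrict : ∀ {n} → Subset n → Point n → Point n
  restrict B x v = if lookup B v then x v else 0#

  -- For pairwise disjoint τ₁, …, τ_k, the Cartesian product of sets
  -- Qⱼ ⊂ ℝ^{τⱼ}, as a subset of ℝ^{τ₁} × … × ℝ^{τ_k} = ℝ^{τ₁ ∪ … ∪ τ_k} ⊂ ℝⁿ.
  CartesianProduct : ∀ {k n} → (Fin k → Subset n) → (Fin k → PointSet n) →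
                     PointSet n
  CartesianProduct τ Q x =
    (∀ v → (∀ j → v ∉ τ j) → x v ≈ 0#) ×
    (∀ j → restrict (τ j) x Unary.∈ Q j)

  -- P is a product of k simplices, the factors being dilated faces of the
  -- standard simplex on disjoint sets of coordinates. The number of factors
  -- and the position of P in ℝⁿ both matter: for a cell σ = σ₁ × … × σ_g the
  -- disjointness of the σᵢ is visible neither in π(σ) alone (with g = 2 and
  -- σ₁ = σ₂ = {1}, or with g = 1 and σ₁ = {1}, it is the point e₁) nor in g and
  -- the affine type of π(σ) (σ₁ = {1,2} with σ₂ = {1} or σ₂ = {3} gives two
  -- segments; {1,2} + {2,3} is a parallelogram).
  IsProductOfSimplices : ∀ {n} → ℕ → PointSet n → Set (c ⊔ ℓ₁ ⊔ ℓ₂)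
  IsProductOfSimplices {n} k P =
    Σ (Fin k → Subset n) λ τ → Σ (Positives k) λ μ →
      (∀ j → Nonempty (τ j)) ×
      PairwiseDisjoint τ ×
      P ≐ CartesianProduct τ (λ j → value μ j • Δ (τ j))

{-# OPTIONS --safe #-}

-- Only "product ⇒ disjoint" needs an idea. Let π(σ) be a product of
-- simplices μⱼ Δ(τⱼ) and suppose v ∈ σ_a ∩ σ_b. Choose cᵢ ∈ σᵢ with
-- c_a = c_b = v. The coordinates in τⱼ of the point Σᵢ wᵢ e(cᵢ) of π(σ) sum to
-- μⱼ > 0, so τⱼ contains some c_{s(j)}. As the τⱼ are disjoint, s is an
-- injective self-map of [g], hence surjective: a = s(j) and b = s(j′), and
-- v ∈ τⱼ ∩ τⱼ′ forces j = j′, so a = b.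

module Submission where

open import Defs
open import Data.Fin.Base using (Fin)
open import Data.Fin.Subset using (Subset)
open import Data.Nat.Base using (ℕ; NonZero)
open import Data.Product.Base using (Σ; ∃-syntax; _×_)
open import Function.Bundles using (_⇔_)
open import Level using (Level)
open import Relation.Unary using (_∈_)

import Algebra.Apartness.Properties.HeytingCommutativeRing as HeytingProperties
open import Algebra.Bundles using (CommutativeRing)
import Algebra.Properties.Ring as RingProperties
import Algebra.Properties.Semiring.Sum as SemiringSum
open import Data.Bool.Base using (true; false)
open import Data.Fin.Base using (punchOut)
open import Data.Fin.Properties
  using (_≟_; any?; punchInᵢ≢i; punchOut-injective; injective⇒≤)
open import Data.Fin.Subset using (Nonempty)
  renaming (_∈_ to _∈ₛ_; _∉_ to _∉ₛ_)
open import Data.Fin.Subset.Properties using (_∈?_; x∈p∩q⁺; x∈p∩q⁻)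
open import Data.Nat.Base using (suc)
open import Data.Nat.Properties using (1+n≰n; nonZero?)
open import Data.Product.Base using (_,_; proj₁; proj₂; map₂)
open import Data.Sum.Base using (inj₁; inj₂)
open import Data.Vec.Base using (lookup; tabulate)
open import Data.Vec.Functional using (Vector; removeAt)
open import Data.Vec.Properties
  using (tabulate∘lookup; lookup⇒[]=; []=⇒lookup)
open import Function.Base using (_∘_; it)
open import Function.Bundles using (mk⇔)
open import Function.Definitions using (Injective)
open import Relation.Binary.PropositionalEquality.Core as ≡ using (_≡_; _≢_)
import Relation.Binary.Reasoning.Setoid as ≈-Reasoning
open import Relation.Nullary.Decidable using (yes; no; dec-true; dec-false; recompute)
open import Relation.Nullary.Negation using (contradiction; ¬_)
open import Relation.Unary using (_≐_; _⊆_)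
open import Relation.Unary.Properties using (≐-sym; ≐-trans)

-- Finite combinatorics of indices and vertices.

injective⇒surjective : ∀ {n} {f : Fin n → Fin n} → Injective _≡_ _≡_ f →
                       ∀ y → ∃[ x ] f x ≡ y
injective⇒surjective {suc n} {f} inj y with any? (λ x → f x ≟ y)
... | yes hit = hit
-- Were `y` missed, punching it out of the codomain would inject `Fin (suc n)` into `Fin n`.
... | no miss = contradiction (injective⇒≤ punched-injective) 1+n≰n
  where
  y≢f : ∀ x → y ≢ f x
  y≢f x y≡fx = miss (x , ≡.sym y≡fx)

  punched-injective : Injective _≡_ _≡_ (λ x → punchOut (y≢f x))
  punched-injective = inj ∘ punchOut-injective (y≢f _) (y≢f _)

-- Membership in `σ i` is decidable, so `v` is picked wherever it is available and the given witness
-- elsewhere. One choice thus meets `v` in all the faces containing it at once.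
choice-through : ∀ {g h} (σ : Fin g → Subset h) → (∀ i → Nonempty (σ i)) →
                 ∀ v → ∃[ c ] (∀ i → c i ∈ₛ σ i) × (∀ i → v ∈ₛ σ i → c i ≡ v)
choice-through σ ne v = proj₁ ∘ pick , proj₁ ∘ proj₂ ∘ pick , proj₂ ∘ proj₂ ∘ pick
  where
  pick : ∀ i → ∃[ u ] u ∈ₛ σ i × (v ∈ₛ σ i → u ≡ v)
  pick i with v ∈? σ i
  ... | yes v∈ = v , v∈ , λ _ → ≡.refl
  ... | no v∉  = proj₁ (ne i) , proj₂ (ne i) , λ v∈ → contradiction v∈ v∉

-- Decidable equality of indices turns disjointness into its positive form, applied below to the
-- faces `σ` as well as to the factors `τ`.
disjoint⇒≡ : ∀ {k n} {τ : Fin k → Subset n} → PairwiseDisjoint τ →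
             ∀ {i j v} → v ∈ₛ τ i → v ∈ₛ τ j → i ≡ j
disjoint⇒≡ disj {i} {j} v∈i v∈j with i ≟ j
... | yes i≡j = i≡j
... | no i≢j  = contradiction (_ , x∈p∩q⁺ (v∈i , v∈j)) (disj i j i≢j)

-- With no edges in the source graph, every tuple of nonempty faces is a cell.
edgeless : ∀ n → Graph n
edgeless n = record
  { adjacent  = λ _ _ → false
  ; symmetric = λ _ _ → ≡.refl
  }

module _ {c ℓ₁ ℓ₂ : Level} (K : OrderedField c ℓ₁ ℓ₂) where

  open OrderedField K
  open Polytopes K
  open HeytingProperties heytingCommutativeRing using (invertibleʳ⇒#; x-0≈x)
  open SemiringSum (CommutativeRing.semiring commutativeRing)
    using (sum-cong-≋; sum-remove; sum-replicate-zero; ∑-comm;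
           *-distribˡ-sum)
  open RingProperties (CommutativeRing.ring commutativeRing)
    using (-1*x≈-x; -‿involutive; -‿distribʳ-*)
  open ≈-Reasoning setoid

  -- Signs in an ordered field.

  pos≉0 : ∀ {x} → 0# < x → ¬ (x ≈ 0#)
  pos≉0 0<x x≈0 = <.irrefl (sym x≈0) 0<x

  neg-pos : ∀ {x} → x < 0# → 0# < - x
  neg-pos {x} x<0 =
    <.<-respˡ-≈ (-‿inverseʳ x) (<.<-respʳ-≈ (+-identityˡ _) (+-monoˡ-< (- x) x<0))

  -- If 1 were negative, -1 would be positive, and so would its square, which is 1.
  0≤1 : 0# ≤ 1#
  0≤1 1<0 = <.asym 1<0 (<.<-respʳ-≈ -1*-1≈1 (*-pos (neg-pos 1<0) (neg-pos 1<0)))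
    where
    -1*-1≈1 : - 1# * - 1# ≈ 1#
    -1*-1≈1 = trans (-1*x≈-x (- 1#)) (-‿involutive 1#)

  -- Being invertible, the inverse is apart from 0 and hence has a sign. Were it negative, `x` times
  -- its negative, which is -1, would be positive, against `0≤1`.
  inv-pos : ∀ {x} (0<x : 0# < x) → 0# < inv x 0<x
  inv-pos {x} 0<x with #⇒<⊎> x⁻¹#0
    where
    x⁻¹#0 : inv x 0<x # 0#
    x⁻¹#0 = invertibleʳ⇒#
      (x , trans (*-congʳ (x-0≈x _)) (trans (*-comm _ _) (inv-inverseʳ x 0<x)))
  ... | inj₂ 0<x⁻¹ = 0<x⁻¹
  ... | inj₁ x⁻¹<0 = contradiction (<.<-respˡ-≈ (+-identityˡ 1#)
        (<.<-respʳ-≈ (-‿inverseˡ 1#) (+-monoˡ-< 1# 0<-1))) 0≤1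
    where
    0<-1 : 0# < - 1#
    0<-1 = <.<-respʳ-≈
      (trans (sym (-‿distribʳ-* x (inv x 0<x))) (-‿cong (inv-inverseʳ x 0<x)))
      (*-pos 0<x (neg-pos x⁻¹<0))

  -- Finite sums, restrictions and unit vectors.

  sum-zero : ∀ {n} {t : Vector Carrier n} → (∀ i → t i ≈ 0#) → sum t ≈ 0#
  sum-zero {n} t≈0 = trans (sum-cong-≋ t≈0) (sum-replicate-zero n)

  sum-single : ∀ {n} (t : Vector Carrier n) i →
               (∀ j → j ≢ i → t j ≈ 0#) → sum t ≈ t i
  sum-single {suc n} t i t≈0 = begin
    sum t                     ≈⟨ sum-remove t ⟩
    t i + sum (removeAt t i)  ≈⟨ +-congˡ (sum-zero (λ j → t≈0 _ (punchInᵢ≢i i j))) ⟩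
    t i + 0#                  ≈⟨ +-identityʳ (t i) ⟩
    t i                       ∎

  restrict-∈ : ∀ {n} (B : Subset n) x {v} → v ∈ₛ B → restrict B x v ≈ x v
  restrict-∈ B x v∈B rewrite []=⇒lookup v∈B = refl

  restrict-∉ : ∀ {n} (B : Subset n) x {v} → v ∉ₛ B → restrict B x v ≈ 0#
  restrict-∉ B x {v} v∉B with lookup B v in eq
  ... | false = refl
  ... | true  = contradiction (lookup⇒[]= v B eq) v∉B

  e-≡ : ∀ {n} (u : Fin n) → e u u ≈ 1#
  e-≡ u rewrite dec-true (u ≟ u) ≡.refl = refl

  e-≢ : ∀ {n} {u v : Fin n} → u ≢ v → e u v ≈ 0#
  e-≢ {u = u} {v} u≢v rewrite dec-false (u ≟ v) u≢v = refl

  sum-e : ∀ {n} (u : Fin n) → sum (e u) ≈ 1#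
  sum-e u = trans (sum-single (e u) u (λ v v≢u → e-≢ (v≢u ∘ ≡.sym))) (e-≡ u)

  -- Supports and coordinate sums of points of simplices.

  module _ {n} {B : Subset n} where

    e∈Δ : ∀ {u} → u ∈ₛ B → e u ∈ Δ B
    e∈Δ {u} u∈B = 1 , (λ _ → e u) , (λ _ → 1#) ,
      (λ _ → u , u∈B , λ _ → refl) , (λ _ → 0≤1) , +-identityʳ 1# ,
      λ v → sym (trans (+-identityʳ _) (*-identityˡ (e u v)))

    Δ-support : ∀ {x v} → x ∈ Δ B → v ∉ₛ B → x v ≈ 0#
    Δ-support {v = v} (k , p , t , p∈ , _ , _ , x≋) v∉B = trans (x≋ v)
      (sum-zero λ i → trans (*-congˡ (pᵢv≈0 (p∈ i))) (zeroʳ (t i)))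
      where
      pᵢv≈0 : ∀ {y} → (∃[ u ] u ∈ₛ B × y ≋ e u) → y v ≈ 0#
      pᵢv≈0 (u , u∈B , y≋) =
        trans (y≋ v) (e-≢ λ u≡v → v∉B (≡.subst (_∈ₛ B) u≡v u∈B))

    Δ-sum : ∀ {x} → x ∈ Δ B → sum x ≈ 1#
    Δ-sum {x} (k , p , t , p∈ , _ , sum-t , x≋) = begin
      sum x                                ≈⟨ sum-cong-≋ x≋ ⟩
      ∑[ v < n ] ∑[ i < k ] (t i * p i v)  ≈⟨ ∑-comm (λ v i → t i * p i v) ⟩
      ∑[ i < k ] ∑[ v < n ] (t i * p i v)  ≈⟨ sum-cong-≋ (λ i → sym (*-distribˡ-sum (t i) (p i))) ⟩
      ∑[ i < k ] (t i * sum (p i))         ≈⟨ sum-cong-≋ (λ i → *-congˡ (sum-p i)) ⟩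
      ∑[ i < k ] (t i * 1#)                ≈⟨ sum-cong-≋ (λ i → *-identityʳ (t i)) ⟩
      sum t                                ≈⟨ sum-t ⟩
      1#                                   ∎
      where
      sum-p : ∀ i → sum (p i) ≈ 1#
      sum-p i with u , _ , pᵢ≋ ← p∈ i = trans (sum-cong-≋ pᵢ≋) (sum-e u)

    module _ {r : Carrier} where

      •Δ-support : ∀ {x v} → x ∈ r • Δ B → v ∉ₛ B → x v ≈ 0#
      •Δ-support {v = v} (q , q∈ , x≋) v∉B =
        trans (x≋ v) (trans (*-congˡ (Δ-support q∈ v∉B)) (zeroʳ r))

      -- The coordinate sum recovers the dilation factor, so for positive `r` no point of the
      -- dilated simplex vanishes in all coordinates.
      •Δ-sum : ∀ {x} → x ∈ r • Δ B → sum x ≈ r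
      •Δ-sum {x} (q , q∈ , x≋) = begin
        sum x                 ≈⟨ sum-cong-≋ x≋ ⟩
        ∑[ v < n ] (r * q v)  ≈⟨ *-distribˡ-sum r q ⟨
        r * sum q             ≈⟨ *-congˡ (Δ-sum q∈) ⟩
        r * 1#                ≈⟨ *-identityʳ r ⟩
        r                     ∎

  -- An arbitrary point set need not respect `≋`, but a dilated one does, since membership in it is
  -- itself stated up to `≋`.
  •-resp-≋ : ∀ {n} {Q : PointSet n} {r x y} → x ≋ y → x ∈ r • Q → y ∈ r • Q
  •-resp-≋ x≋y (q , q∈ , x≋) = q , q∈ , λ v → trans (sym (x≋y v)) (x≋ v)

  -- Both inclusions keep the points of the `Q i` and change only the coefficients. A separate `t`
  -- lets the result be stated for the weights, which agree with `r * s i` only up to `≈`.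
  •-MinkowskiSum-• : ∀ {k n} r (s t : Vector Carrier k) (Q : Fin k → PointSet n) →
    (∀ i → r * s i ≈ t i) →
    r • MinkowskiSum (λ i → s i • Q i) ≐ MinkowskiSum (λ i → t i • Q i)
  •-MinkowskiSum-• {k} {n} r s t Q rs≈t = to , from
    where
    scale : ∀ (p q : Fin k → Point n) → (∀ i → p i ≋ λ v → s i * q i v) →
            ∀ v → r * ∑[ i < k ] p i v ≈ ∑[ i < k ] (t i * q i v)
    scale p q p≋ v = trans (*-distribˡ-sum r (λ i → p i v)) (sum-cong-≋ λ i → begin
      r * p i v          ≈⟨ *-congˡ (p≋ i v) ⟩
      r * (s i * q i v)  ≈⟨ *-assoc r (s i) (q i v) ⟨
      r * s i * q i v    ≈⟨ *-congʳ (rs≈t i) ⟩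
      t i * q i v        ∎)

    to : r • MinkowskiSum (λ i → s i • Q i) ⊆ MinkowskiSum (λ i → t i • Q i)
    to (y , (p , p∈ , y≋) , x≋) =
      (λ i v → t i * q i v) ,
      (λ i → q i , proj₁ (proj₂ (p∈ i)) , λ _ → refl) ,
      λ v → trans (x≋ v)
        (trans (*-congˡ (y≋ v)) (scale p q (proj₂ ∘ proj₂ ∘ p∈) v))
      where
      q = proj₁ ∘ p∈

    from : MinkowskiSum (λ i → t i • Q i) ⊆ r • MinkowskiSum (λ i → s i • Q i)
    from (p , p∈ , x≋) =
      (λ v → ∑[ i < k ] (s i * q i v)) ,
      ((λ i v → s i * q i v) ,
       (λ i → q i , proj₁ (proj₂ (p∈ i)) , λ _ → refl) ,
       λ _ → refl) ,
      λ v → trans (x≋ v) (trans (sum-cong-≋ (λ i → proj₂ (proj₂ (p∈ i)) v))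
        (sym (scale (λ i v → s i * q i v) q (λ _ _ → refl) v)))
      where
      q = proj₁ ∘ p∈

  MinkowskiSum-mono : ∀ {k n} {P Q : Fin k → PointSet n} → (∀ i → P i ⊆ Q i) →
                      MinkowskiSum P ⊆ MinkowskiSum Q
  MinkowskiSum-mono P⊆Q (p , p∈ , x≋) = p , (λ i → P⊆Q i (p∈ i)) , x≋

  -- Cells of the projected complex.

  module _ {g : ℕ} .{{_ : NonZero g}} (λs : Positives g) where

    0<total : 0# < total λs
    0<total = sum-pos (value λs) (positive λs)

    weights : Positives g
    weights = record
      { value    = weight λs
      ; positive = λ i → *-pos (positive λs i) (inv-pos 0<total)
      }

    module _ {h : ℕ} (σ : Fin g → Subset h) where

      πCell≐MinkowskiSum : πCell λs σ ≐ MinkowskiSum (λ i → weight λs i • Δ (σ i))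
      πCell≐MinkowskiSum =
        (λ { ((p , _) , (p∈ , _) , z≋) → p , p∈ , z≋ }) ,
        (λ { (p , p∈ , z≋) → (p , weight λs) , (p∈ , λ _ → refl) , z≋ })

      πCell-generalizedPermutohedron :
        (∀ i → Nonempty (σ i)) → IsGeneralizedPermutohedron (πCell λs σ)
      -- The instance of `NonZero g` is irrelevant; decidability recovers the relevant proof that
      -- the goal demands.
      πCell-generalizedPermutohedron ne = g , recompute (nonZero? g) it , Γ , weights ,
        ≐-trans πCell≐MinkowskiSum
          (MinkowskiSum-mono (λ i {x} → ≡.subst (λ B → x ∈ weight λs i • Δ B) (σ≡I i)) ,
           MinkowskiSum-mono (λ i {x} → ≡.subst (λ B → x ∈ weight λs i • Δ B) (≡.sym (σ≡I i))))
        where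
        -- The neighbourhoods of `Γ` are tabulated lookups, equal to the faces only propositionally,
        -- so memberships are transported along this equation.
        σ≡I : ∀ i → σ i ≡ tabulate (lookup (σ i))
        σ≡I i = ≡.sym (tabulate∘lookup (σ i))

        Γ : BipartiteGraph g h
        Γ = record
          { adjacent   = λ i → lookup (σ i)
          ; I-nonempty = λ i → ≡.subst Nonempty (σ≡I i) (ne i)
          }

      -- The faces themselves serve as `τ` and the weights as `μ`. At each coordinate at most one
      -- summand can be nonzero, so restricting a sum to `σ j` recovers its `j`-th summand, and a
      -- point of the product is the sum of its restrictions.
      disjoint⇒product : (∀ i → Nonempty (σ i)) → PairwiseDisjoint σ →
                         IsProductOfSimplices g (πCell λs σ)
      disjoint⇒product ne disj =
        σ , weights , ne , disj , ≐-trans πCell≐MinkowskiSum (to , from)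
        where
        to : MinkowskiSum (λ i → weight λs i • Δ (σ i)) ⊆
             CartesianProduct σ (λ i → weight λs i • Δ (σ i))
        to {x} (p , p∈ , x≋) =
          (λ v v∉ → trans (x≋ v) (sum-zero λ i → •Δ-support (p∈ i) (v∉ i))) ,
          (λ j → •-resp-≋ (λ v → sym (restricted j v)) (p∈ j))
          where
          restricted : ∀ j → restrict (σ j) x ≋ p j
          restricted j v with v ∈? σ j
          ... | no v∉  = trans (restrict-∉ (σ j) x v∉) (sym (•Δ-support (p∈ j) v∉))
          ... | yes v∈ = trans (restrict-∈ (σ j) x v∈) (trans (x≋ v)
                (sum-single (λ i → p i v) j λ i i≢j →
                  •Δ-support (p∈ i) (λ v∈i → i≢j (disjoint⇒≡ disj v∈i v∈))))

        from : CartesianProduct σ (λ i → weight λs i • Δ (σ i)) ⊆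
               MinkowskiSum (λ i → weight λs i • Δ (σ i))
        from {x} (x≈0 , x∈) = (λ i → restrict (σ i) x) , x∈ , x≋
          where
          x≋ : x ≋ λ v → ∑[ i < g ] restrict (σ i) x v
          x≋ v with any? (λ j → v ∈? σ j)
          ... | no v∉         = trans (x≈0 v (λ j v∈ → v∉ (j , v∈)))
                (sym (sum-zero λ i → restrict-∉ (σ i) x (λ v∈ → v∉ (i , v∈))))
          ... | yes (j , v∈j) = sym (trans
                (sum-single (λ i → restrict (σ i) x v) j λ i i≢j →
                  restrict-∉ (σ i) x (λ v∈i → i≢j (disjoint⇒≡ disj v∈i v∈j)))
                (restrict-∈ (σ j) x v∈j))

      product⇒disjoint : (∀ i → Nonempty (σ i)) →
                         IsProductOfSimplices g (πCell λs σ) → PairwiseDisjoint σ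
      product⇒disjoint ne (τ , μ , _ , τ-disj , πCell⊆ , _) a b a≢b (v , v∈)
        with v∈a , v∈b ← x∈p∩q⁻ (σ a) (σ b) v∈
        with c , c∈ , c≡v ← choice-through σ ne v
        = a≢b a≡b
        where
        z : Point h
        z u = ∑[ i < g ] (weight λs i * e (c i) u)

        z∈ : z ∈ CartesianProduct τ (λ j → value μ j • Δ (τ j))
        z∈ = πCell⊆ (proj₂ πCell≐MinkowskiSum
          ((λ i u → weight λs i * e (c i) u) ,
           (λ i → e (c i) , e∈Δ (c∈ i) , λ _ → refl) ,
           λ _ → refl))

        hit : ∀ j → ∃[ i ] c i ∈ₛ τ j
        hit j with any? (λ i → c i ∈? τ j)
        ... | yes i∈ = i∈
        -- If `τ j` contained no `c i`, the restriction of `z` to it would vanish, although its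
        -- coordinates sum to `value μ j`.
        ... | no miss = contradiction
          (trans (sym (•Δ-sum (proj₂ z∈ j))) (sum-zero restrict≈0))
          (pos≉0 (positive μ j))
          where
          restrict≈0 : ∀ u → restrict (τ j) z u ≈ 0#
          restrict≈0 u with u ∈? τ j
          ... | no u∉  = restrict-∉ (τ j) z u∉
          ... | yes u∈ = trans (restrict-∈ (τ j) z u∈) (sum-zero λ i →
            trans (*-congˡ (e-≢ λ cᵢ≡u → miss (i , ≡.subst (_∈ₛ τ j) (≡.sym cᵢ≡u) u∈)))
                  (zeroʳ _))

        s : Fin g → Fin g
        s = proj₁ ∘ hit

        -- If `s j` and `s j′` agree, the vertex chosen there lies in both `τ j` and `τ j′`.
        s-injective : Injective _≡_ _≡_ s
        s-injective {j} {j′} eq = disjoint⇒≡ τ-disj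
          (proj₂ (hit j)) (≡.subst (λ i → c i ∈ₛ τ j′) (≡.sym eq) (proj₂ (hit j′)))

        -- Surjectivity of `s` writes `i` as `s j`, and the vertex of `τ j` chosen at `i` is `v`.
        v∈τ : ∀ {i} → v ∈ₛ σ i → ∃[ j ] s j ≡ i × v ∈ₛ τ j
        v∈τ {i} v∈σ with j , ≡.refl ← injective⇒surjective s-injective i =
          j , ≡.refl , ≡.subst (_∈ₛ τ j) (c≡v _ v∈σ) (proj₂ (hit j))

        a≡b : a ≡ b
        a≡b with j , sj≡a , v∈j ← v∈τ v∈a | j′ , sj′≡b , v∈j′ ← v∈τ v∈b =
          ≡.trans (≡.sym sj≡a)
            (≡.trans (≡.cong s (disjoint⇒≡ τ-disj v∈j v∈j′)) sj′≡b)

theorem2p11 : {c ℓ₁ ℓ₂ : Level} (K : OrderedField c ℓ₁ ℓ₂) →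
    let open OrderedField K
        open Polytopes K
    in
    (∀ {g h : ℕ} .{{_ : NonZero g}} (G : Graph g) (H : Graph h)
       (λs : Positives g) (P : PointSet h) →
       P ∈ πHom λs G H → IsGeneralizedPermutohedron P)
    ×
    (∀ {m n : ℕ} .{{_ : NonZero m}} (Γ : BipartiteGraph m n)
       (λs : Positives m) →
       Σ (Graph m) λ G → Σ (Graph n) λ H →
         ∃[ r ] (0# < r × (r • P⟨ Γ ⟩ λs) ∈ πHom λs G H))
    ×
    (∀ {g h : ℕ} .{{_ : NonZero g}} (G : Graph g) (H : Graph h)
       (λs : Positives g) (σ : Fin g → Subset h) →
       IsHomCell G H σ →
       IsProductOfSimplices g (πCell λs σ) ⇔ PairwiseDisjoint σ)
theorem2p11 K = cells , realization , products
  where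
  open OrderedField K
  open Polytopes K

  cells : ∀ {g h : ℕ} .{{_ : NonZero g}} (G : Graph g) (H : Graph h)
          (λs : Positives g) (P : PointSet h) →
          P ∈ πHom λs G H → IsGeneralizedPermutohedron P
  cells G H λs P (σ , (ne , _) , P≐) =
    -- The four `map₂` pass over `m`, its nonzeroness, the bipartite graph and the coefficients to
    -- reach the equality of point sets.
    map₂ (map₂ (map₂ (map₂ (≐-trans P≐)))) (πCell-generalizedPermutohedron K λs σ ne)

  realization : ∀ {m n : ℕ} .{{_ : NonZero m}} (Γ : BipartiteGraph m n)
    (λs : Positives m) →
    Σ (Graph m) λ G → Σ (Graph n) λ H →
      ∃[ r ] (0# < r × (r • P⟨ Γ ⟩ λs) ∈ πHom λs G H)
  realization {m} {n} Γ λs =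
    -- Dilating by the reciprocal of the total turns each `value λs i` into `weight λs i`; the
    -- neighbourhoods `I i` are the faces of the cell.
    edgeless m , edgeless n , r , inv-pos K (0<total K λs) ,
    I , (I-nonempty , λ _ _ ()) ,
    ≐-trans (•-MinkowskiSum-• K r (value λs) (weight λs) (Δ ∘ I) (λ i → *-comm r (value λs i)))
            (≐-sym (πCell≐MinkowskiSum K λs I))
    where
    open BipartiteGraph Γ
    r : Carrier
    r = inv (total λs) (0<total K λs)

  products : ∀ {g h : ℕ} .{{_ : NonZero g}} (G : Graph g) (H : Graph h)
    (λs : Positives g) (σ : Fin g → Subset h) →
    IsHomCell G H σ →
    IsProductOfSimplices g (πCell λs σ) ⇔ PairwiseDisjoint σ
  products G H λs σ (ne , _) =
    mk⇔ (product⇒disjoint K λs σ ne) (disjoint⇒product K λs σ ne)
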